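{- Let $A$ be a formula and $\Gamma$ a context of higher-order logic. (1) If $\Gamma_{Ku}\vdash_i A^{Ku}$ then $\Gamma\vdash_c^{\mathfrak{e}\mathfrak{f}\mathfrak{p}} A$. (2) For each $*\in\{\mathfrak{e},\mathfrak{e}\mathfrak{p}\}$: if $\Gamma_{Ku}\vdash_i^* A^{Ku}$ then $\Gamma\vdash_c^{\mathfrak{e}\mathfrak{f}\mathfrak{p}} A$. (3) For each $*\in\{\mathfrak{e}\mathfrak{f},\mathfrak{e}\mathfrak{f}\mathfrak{p}\}$: if $\Delta^{\mathfrak{f}},\Gamma_{Ku}\vdash_i^* A^{Ku}$ then $\Gamma\vdash_c^{\mathfrak{e}\mathfrak{f}\mathfrak{p}} A$.
   Context: Syntax. Simple types are generated by: $\iota$ (individuals), $o$ (propositions), and $\tau \to \sigma$ for types $\tau,\sigma$. For each type $\tau$ there are a set $\mathcal{V}_\tau$ of variables (infinitely many, as usual) and a set $\mathcal{C}_\tau$ of constants; variables and constants are disjoint. Terms are simply typed: variables and constants of type $\tau$ are terms of type $\tau$; if $x\in\mathcal{V}_\tau$ and $t$ has type $\sigma$, then $\lambda x.t$ has type $\tau\to\sigma$; if $t$ has type $\tau\to\sigma$ and $u$ has type $\tau$, then $t\,u$ has type $\sigma$. Terms are taken up to renaming of bound variables; $t[x\leftarrow u]$ is capture-avoiding substitution; $\equiv_\beta$ is the congruence generated by $(\lambda x.t)u \hookrightarrow t[x\leftarrow u]$ (no $\eta$). Formulas are terms of type $o$. The constants include $\top,\bot$ of type $o$; $\neg$ of type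 $o\to o$; $\Rightarrow,\wedge,\vee$ of type $o\to o\to o$; and for every type $\tau$, $\forall_\tau,\exists_\tau$ of type $(\tau\to o)\to o$ and $=_\tau$ of type $\tau\to\tau\to o$ (written infix); there may be further constants. $\forall x.A$ and $\exists x.A$ abbreviate $\forall_\tau(\lambda x.A)$, $\exists_\tau(\lambda x.A)$; $A\Leftrightarrow B := (A\Rightarrow B)\wedge(B\Rightarrow A)$. $FV$ denotes free variables. A context is a finite sequence of formulas. Derivability. Intuitionistic logic has the usual natural deduction rules: introduction and elimination for $\Rightarrow,\wedge,\vee$; Not-I: from $\Gamma,A\vdash\bot$ infer $\Gamma\vdash\neg A$; Not-E: from $\Gamma\vdash\neg A$ and $\Gamma\vdash A$ infer $\Gamma\vdash\bot$; Bot-E: from $\Gamma\vdash\bot$ infer $\Gamma\vdash A$; Top-I: $\Gamma\vdash\top$; All-I: from $\Gamma\vdash P\,x$ with $x\notin FV(\Gamma,P)$ infer $\Gamma\vdash\forall P$; All-E: from $\Gamma\vdash\forall P$ infer $\Gamma\vdash P\,t$; Ex-I: from $\Gamma\vdash P\,t$ infer $\Gamma\vdash\exists P$; Ex-E: from $\Gamma\vdash\exists P$ and $\Gamma,P\,x\vdash A$ with $x\notin FV(\Gamma,P,A)$ infer $\Gamma\vdash A$; Ax: $\Gamma,A,\Delta\vdash A$; Conv: from $\Gamma\vdash A$ and $A\equiv_\beta B$ infer $\Gamma\vdash B$. Classical logic adds PEM: $\Gamma\vdash A\vee\neg A$. $\Gamma\vdash_i A$ and $\Gamma\vdash_c A$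 denote intuitionistic and classical derivability. Equality rules. Eq-I: $\Gamma\vdash u=u$. Eq-E: from $\Gamma\vdash P\,u$ and $\Gamma\vdash u=v$ infer $\Gamma\vdash P\,v$. FunExt: from $\Gamma\vdash f\,x=g\,x$ with $x\notin FV(\Gamma,f,g)$ infer $\Gamma\vdash f=g$. PropExt: from $\Gamma\vdash A\Leftrightarrow B$ infer $\Gamma\vdash A=B$. For $k\in\{c,i\}$ and $*\in\{\mathfrak{e},\mathfrak{e}\mathfrak{p},\mathfrak{e}\mathfrak{f},\mathfrak{e}\mathfrak{f}\mathfrak{p}\}$, $\Gamma\vdash_k^* A$ means derivability in the logic $k$ with the additional rules Eq-I and Eq-E if $\mathfrak{e}$ occurs in $*$, PropExt if $\mathfrak{p}$ occurs in $*$, and FunExt if $\mathfrak{f}$ occurs in $*$. Kuroda's translation. For a term $t$, $t_{Ku}$ is defined by: $x_{Ku}:=x$ for variables; $(\forall_\tau)_{Ku}:=\lambda p.\forall_\tau(\lambda x.\neg\neg(p\,x))$ for each type $\tau$; $c_{Ku}:=c$ for every other constant; $(\lambda x.t)_{Ku}:=\lambda x.t_{Ku}$; $(t\,u)_{Ku}:=t_{Ku}\,u_{Ku}$. For a formula $A$, $A^{Ku}:=\neg\neg A_{Ku}$. For a context $\Gamma=A_1,\dots,A_n$, $\Gamma_{Ku}:=(A_1)_{Ku},\dots,(A_n)_{Ku}$. $\Delta^{\mathfrak{f}}$ is $\forall f\,\forall g.\,(\forall x.\,\neg\neg(f\,x=g\,x))\Rightarrow\neg\neg(f=g)$, with $f,g$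 of type $\tau\to\sigma$ and $x$ of type $\tau$, for all types $\tau,\sigma$; having $\Delta^{\mathfrak{f}}$ in a context means that finitely many of these type instances may be used as hypotheses. -}

module Defs where

open import Data.List.Base using (List; []; _∷_; _++_; map)
open import Data.List.Membership.Propositional using (_∈_; _∉_)
open import Data.List.Relation.Binary.Subset.Propositional using (_⊆_)
open import Data.List.Relation.Binary.Subset.Propositional.Properties using (∷⁺ʳ)
open import Data.List.Relation.Unary.All using (All)
open import Data.List.Relation.Unary.Any using (here; there)
open import Data.Product.Base using (∃; _×_; _,_)
open import Relation.Binary.Definitions using (DecidableEquality)
open import Relation.Binary.PropositionalEquality using (_≡_; refl)
open import Relation.Nullary using (¬_)

infixr 6 _⟶_

data Ty : Set where
  ι   : Ty
  o   : Ty
  _⟶_ : Ty → Ty → Ty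

-- `fresh` says constructively that there are infinitely many variables of
-- every type.  `OtherConst` holds the constants that are not logical symbols.
record Signature : Set₁ where
  field
    Var        : Ty → Set
    _≟ᵛ_       : ∀ {τ} → DecidableEquality (Var τ)
    fresh      : ∀ {τ} (xs : List (Var τ)) → ∃ λ x → x ∉ xs
    OtherConst : Ty → Set

data Logic : Set where
  int cls : Logic

data EqRule : Set where
  eq funExt propExt : EqRule

EqRules : Set
EqRules = List EqRule

𝔢 𝔢𝔭 𝔢𝔣 𝔢𝔣𝔭 : EqRules
𝔢   = eq ∷ []
𝔢𝔭  = eq ∷ propExt ∷ []
𝔢𝔣  = eq ∷ funExt ∷ []
𝔢𝔣𝔭 = eq ∷ funExt ∷ propExt ∷ []

module HOL (S : Signature) where
  open Signature S

  data Const : Ty → Set where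
    ⊤ᶜ ⊥ᶜ    : Const o
    ¬ᶜ       : Const (o ⟶ o)
    ⇒ᶜ ∧ᶜ ∨ᶜ : Const (o ⟶ o ⟶ o)
    ∀ᶜ ∃ᶜ    : ∀ τ → Const ((τ ⟶ o) ⟶ o)
    =ᶜ       : ∀ τ → Const (τ ⟶ τ ⟶ o)
    other    : ∀ {τ} → OtherConst τ → Const τ

  infixl 9 _·_

  -- Locally nameless terms: variables of the signature occur only free, and
  -- λ binds typed de Bruijn indices, so terms equal up to renaming of bound
  -- variables are identical.  The list holds the types of the enclosing
  -- binders; the terms of the logic are those with no dangling index.
  data Tm (Ξ : List Ty) : Ty → Set where
    var : ∀ {τ} → Var τ → Tm Ξ τ
    bnd : ∀ {τ} → τ ∈ Ξ → Tm Ξ τ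
    con : ∀ {τ} → Const τ → Tm Ξ τ
    lam : ∀ {τ σ} → Tm (τ ∷ Ξ) σ → Tm Ξ (τ ⟶ σ)
    _·_ : ∀ {τ σ} → Tm Ξ (τ ⟶ σ) → Tm Ξ τ → Tm Ξ σ

  Term : Ty → Set
  Term = Tm []

  Formula : Set
  Formula = Term o

  -- The most recent hypothesis comes first: Γ , A is A ∷ Γ.
  Context : Set
  Context = List Formula

  pattern #0 = bnd (here refl)
  pattern #1 = bnd (there (here refl))

  infix  8 _=ᶠ_
  infix  7 ¬ᶠ_ ∀ᶠ_ ∃ᶠ_
  infixr 6 _∧ᶠ_
  infixr 5 _∨ᶠ_
  infixr 4 _⇒ᶠ_
  infix  3 _⇔ᶠ_

  ⊤ᶠ ⊥ᶠ : ∀ {Ξ} → Tm Ξ o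
  ⊤ᶠ = con ⊤ᶜ
  ⊥ᶠ = con ⊥ᶜ

  ¬ᶠ_ : ∀ {Ξ} → Tm Ξ o → Tm Ξ o
  ¬ᶠ A = con ¬ᶜ · A

  _⇒ᶠ_ _∧ᶠ_ _∨ᶠ_ _⇔ᶠ_ : ∀ {Ξ} → Tm Ξ o → Tm Ξ o → Tm Ξ o
  A ⇒ᶠ B = con ⇒ᶜ · A · B
  A ∧ᶠ B = con ∧ᶜ · A · B
  A ∨ᶠ B = con ∨ᶜ · A · B
  A ⇔ᶠ B = (A ⇒ᶠ B) ∧ᶠ (B ⇒ᶠ A)

  ∀ᶠ_ ∃ᶠ_ : ∀ {Ξ τ} → Tm Ξ (τ ⟶ o) → Tm Ξ o
  ∀ᶠ P = con (∀ᶜ _) · P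
  ∃ᶠ P = con (∃ᶜ _) · P

  _=ᶠ_ : ∀ {Ξ τ} → Tm Ξ τ → Tm Ξ τ → Tm Ξ o
  t =ᶠ u = con (=ᶜ _) · t · u

  infix 4 _∈FV_ _∉FV_ _∉FVs_

  data _∈FV_ {τ} (x : Var τ) : ∀ {Ξ σ} → Tm Ξ σ → Set where
    var  : ∀ {Ξ} → x ∈FV var {Ξ} x
    lam  : ∀ {Ξ ρ σ} {t : Tm (ρ ∷ Ξ) σ} → x ∈FV t → x ∈FV lam t
    appˡ : ∀ {Ξ ρ σ} {t : Tm Ξ (ρ ⟶ σ)} {u} → x ∈FV t → x ∈FV t · u
    appʳ : ∀ {Ξ ρ σ} {t : Tm Ξ (ρ ⟶ σ)} {u} → x ∈FV u → x ∈FV t · u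

  _∉FV_ : ∀ {τ Ξ σ} → Var τ → Tm Ξ σ → Set
  x ∉FV t = ¬ (x ∈FV t)

  _∉FVs_ : ∀ {τ} → Var τ → Context → Set
  x ∉FVs Γ = All (x ∉FV_) Γ

  rename : ∀ {Ξ Ξ′ τ} → Ξ ⊆ Ξ′ → Tm Ξ τ → Tm Ξ′ τ
  rename ρ (var x) = var x
  rename ρ (bnd i) = bnd (ρ i)
  rename ρ (con c) = con c
  rename ρ (lam t) = lam (rename (∷⁺ʳ _ ρ) t)
  rename ρ (t · u) = rename ρ t · rename ρ u

  Subst : List Ty → List Ty → Set
  Subst Ξ Ξ′ = ∀ {τ} → τ ∈ Ξ → Tm Ξ′ τ

  lift : ∀ {Ξ Ξ′ σ} → Subst Ξ Ξ′ → Subst (σ ∷ Ξ) (σ ∷ Ξ′)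
  lift s (here p)  = bnd (here p)
  lift s (there i) = rename there (s i)

  subst : ∀ {Ξ Ξ′ τ} → Subst Ξ Ξ′ → Tm Ξ τ → Tm Ξ′ τ
  subst s (var x) = var x
  subst s (bnd i) = s i
  subst s (con c) = con c
  subst s (lam t) = lam (subst (lift s) t)
  subst s (t · u) = subst s t · subst s u

  single : ∀ {Ξ σ} → Tm Ξ σ → Subst (σ ∷ Ξ) Ξ
  single u (here refl) = u
  single u (there i)   = bnd i

  _[_] : ∀ {Ξ σ τ} → Tm (σ ∷ Ξ) τ → Tm Ξ σ → Tm Ξ τ
  t [ u ] = subst (single u) t

  infix 4 _≡β_

  data _≡β_ {Ξ} : ∀ {τ} → Tm Ξ τ → Tm Ξ τ → Set where
    β     : ∀ {σ τ} (t : Tm (σ ∷ Ξ) τ) (u : Tm Ξ σ) → lam t · u ≡β t [ u ]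
    refl  : ∀ {τ} {t : Tm Ξ τ} → t ≡β t
    sym   : ∀ {τ} {t u : Tm Ξ τ} → t ≡β u → u ≡β t
    trans : ∀ {τ} {t u v : Tm Ξ τ} → t ≡β u → u ≡β v → t ≡β v
    lam   : ∀ {σ τ} {t t′ : Tm (σ ∷ Ξ) τ} → t ≡β t′ → lam t ≡β lam t′
    app   : ∀ {σ τ} {t t′ : Tm Ξ (σ ⟶ τ)} {u u′ : Tm Ξ σ} →
            t ≡β t′ → u ≡β u′ → t · u ≡β t′ · u′

  infix 2 _⊢[_,_]_

  data _⊢[_,_]_ (Γ : Context) (k : Logic) (* : EqRules) : Formula → Set where
    ax    : ∀ {A} → A ∈ Γ → Γ ⊢[ k , * ] A
    conv  : ∀ {A B} → Γ ⊢[ k , * ] A → A ≡β B → Γ ⊢[ k , * ] B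
    ⊤I    : Γ ⊢[ k , * ] ⊤ᶠ
    ⊥E    : ∀ {A} → Γ ⊢[ k , * ] ⊥ᶠ → Γ ⊢[ k , * ] A
    ¬I    : ∀ {A} → A ∷ Γ ⊢[ k , * ] ⊥ᶠ → Γ ⊢[ k , * ] ¬ᶠ A
    ¬E    : ∀ {A} → Γ ⊢[ k , * ] ¬ᶠ A → Γ ⊢[ k , * ] A → Γ ⊢[ k , * ] ⊥ᶠ
    ⇒I    : ∀ {A B} → A ∷ Γ ⊢[ k , * ] B → Γ ⊢[ k , * ] A ⇒ᶠ B
    ⇒E    : ∀ {A B} → Γ ⊢[ k , * ] A ⇒ᶠ B → Γ ⊢[ k , * ] A → Γ ⊢[ k , * ] B
    ∧I    : ∀ {A B} → Γ ⊢[ k , * ] A → Γ ⊢[ k , * ] B → Γ ⊢[ k , * ] A ∧ᶠ B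
    ∧E₁   : ∀ {A B} → Γ ⊢[ k , * ] A ∧ᶠ B → Γ ⊢[ k , * ] A
    ∧E₂   : ∀ {A B} → Γ ⊢[ k , * ] A ∧ᶠ B → Γ ⊢[ k , * ] B
    ∨I₁   : ∀ {A B} → Γ ⊢[ k , * ] A → Γ ⊢[ k , * ] A ∨ᶠ B
    ∨I₂   : ∀ {A B} → Γ ⊢[ k , * ] B → Γ ⊢[ k , * ] A ∨ᶠ B
    ∨E    : ∀ {A B C} → Γ ⊢[ k , * ] A ∨ᶠ B →
            A ∷ Γ ⊢[ k , * ] C → B ∷ Γ ⊢[ k , * ] C → Γ ⊢[ k , * ] C
    ∀I    : ∀ {τ} {P : Term (τ ⟶ o)} (x : Var τ) → x ∉FVs Γ → x ∉FV P →
            Γ ⊢[ k , * ] P · var x → Γ ⊢[ k , * ] ∀ᶠ P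
    ∀E    : ∀ {τ} {P : Term (τ ⟶ o)} (t : Term τ) →
            Γ ⊢[ k , * ] ∀ᶠ P → Γ ⊢[ k , * ] P · t
    ∃I    : ∀ {τ} {P : Term (τ ⟶ o)} (t : Term τ) →
            Γ ⊢[ k , * ] P · t → Γ ⊢[ k , * ] ∃ᶠ P
    ∃E    : ∀ {τ} {P : Term (τ ⟶ o)} {A} (x : Var τ) →
            x ∉FVs Γ → x ∉FV P → x ∉FV A →
            Γ ⊢[ k , * ] ∃ᶠ P → P · var x ∷ Γ ⊢[ k , * ] A → Γ ⊢[ k , * ] A
    pem   : ∀ {A} → k ≡ cls → Γ ⊢[ k , * ] A ∨ᶠ ¬ᶠ A
    =I    : ∀ {τ} {u : Term τ} → eq ∈ * → Γ ⊢[ k , * ] u =ᶠ u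
    =E    : ∀ {τ} {P : Term (τ ⟶ o)} {u v : Term τ} → eq ∈ * →
            Γ ⊢[ k , * ] P · u → Γ ⊢[ k , * ] u =ᶠ v → Γ ⊢[ k , * ] P · v
    funE  : ∀ {τ σ} {f g : Term (τ ⟶ σ)} → funExt ∈ * →
            (x : Var τ) → x ∉FVs Γ → x ∉FV f → x ∉FV g →
            Γ ⊢[ k , * ] f · var x =ᶠ g · var x → Γ ⊢[ k , * ] f =ᶠ g
    propE : ∀ {A B : Formula} → propExt ∈ * →
            Γ ⊢[ k , * ] A ⇔ᶠ B → Γ ⊢[ k , * ] A =ᶠ B

  ku : ∀ {Ξ τ} → Tm Ξ τ → Tm Ξ τ
  ku (var x)      = var x
  ku (bnd i)      = bnd i
  ku (con (∀ᶜ τ)) = lam (∀ᶠ lam (¬ᶠ ¬ᶠ (#1 · #0)))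
  ku (con c)      = con c
  ku (lam t)      = lam (ku t)
  ku (t · u)      = ku t · ku u

  _ᴷᵘ : Formula → Formula
  A ᴷᵘ = ¬ᶠ ¬ᶠ ku A

  kuᶜ : Context → Context
  kuᶜ = map ku

  Δᶠ : Ty × Ty → Formula
  Δᶠ (τ , σ) =
    ∀ᶠ lam {τ = τ ⟶ σ} (∀ᶠ lam {τ = τ ⟶ σ}
      ((∀ᶠ lam (¬ᶠ ¬ᶠ (bnd (there (there (here refl))) · #0 =ᶠ #1 · #0)))
        ⇒ᶠ ¬ᶠ ¬ᶠ (#1 =ᶠ #0)))

  infix 2 Δᶠ,_⊢[_,_]_

  -- Each derivation uses only finitely many instances of the schema Δᶠ.
  Δᶠ,_⊢[_,_]_ : Context → Logic → EqRules → Formula → Set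
  Δᶠ, Γ ⊢[ k , * ] A = ∃ λ τσs → Γ ++ map Δᶠ τσs ⊢[ k , * ] A

{-# OPTIONS --safe #-}

-- In classical logic with both extensionality rules every term is provably
-- equal to its Kuroda translation: the two versions of ∀ are equal on a fresh
-- predicate by PropExt and double-negation elimination, hence equal by FunExt,
-- and FunExt also carries equalities through λ.  So the hypotheses Γ_Ku follow
-- from Γ, and Δᶠ follows from FunExt and double-negation elimination.  These
-- hypotheses can be cut without renaming eigenvariables, because they are
-- derivable in every extension of Γ and Γ has no free variable that Γ_Ku lacks.
module Submission where

open import Defs
open import Data.List.Base using (List; []; _∷_; _++_; map)
open import Data.List.Membership.Propositional using (_∈_; _∉_)
open import Data.List.Membership.Propositional.Properties
  using (∈-++⁺ˡ; ∈-++⁺ʳ; ∈-++⁻; ∈-map⁻)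
open import Data.List.Properties using (++-identityʳ)
open import Data.List.Relation.Binary.Subset.Propositional using (_⊆_)
open import Data.List.Relation.Binary.Subset.Propositional.Properties using (∷⁺ʳ)
open import Data.List.Relation.Unary.All using ([]; _∷_)
open import Data.List.Relation.Unary.All.Properties using (++⁻ˡ)
open import Data.List.Relation.Unary.Any using (here; there)
open import Data.Product.Base using (∃; _×_; _,_)
open import Data.Sum.Base using ([_,_]′)
open import Function.Base using (_∘_; id)
open import Relation.Binary.Definitions using (DecidableEquality)
open import Relation.Binary.PropositionalEquality as ≡ using (_≡_; refl; cong; cong₂)
open import Relation.Nullary using (yes; no; contradiction)

-- Decidable equality of simple types

_≟ᵀ_ : DecidableEquality Ty
ι ≟ᵀ ι = yes refl
ι ≟ᵀ o = no λ ()
ι ≟ᵀ (_ ⟶ _) = no λ ()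
o ≟ᵀ ι = no λ ()
o ≟ᵀ o = yes refl
o ≟ᵀ (_ ⟶ _) = no λ ()
(_ ⟶ _) ≟ᵀ ι = no λ ()
(_ ⟶ _) ≟ᵀ o = no λ ()
(τ ⟶ σ) ≟ᵀ (τ′ ⟶ σ′) with τ ≟ᵀ τ′ | σ ≟ᵀ σ′
... | yes refl | yes refl = yes refl
... | no τ≢τ′  | _        = no λ { refl → τ≢τ′ refl }
... | yes _    | no σ≢σ′  = no λ { refl → σ≢σ′ refl }

∈𝔢𝔣𝔭 : ∀ r → r ∈ 𝔢𝔣𝔭
∈𝔢𝔣𝔭 eq      = here refl
∈𝔢𝔣𝔭 funExt  = there (here refl)
∈𝔢𝔣𝔭 propExt = there (there (here refl))

module _ (S : Signature) where
  open Signature S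
  open HOL S

  private
    variable
      Ξ Ξ′ Ξ″ : List Ty
      τ σ     : Ty
      Γ Δ     : Context
      A B     : Formula
      k       : Logic
      *       : EqRules

  infix 2 _⊢ᶜ_

  _⊢ᶜ_ : Context → Formula → Set
  Γ ⊢ᶜ A = Γ ⊢[ cls , 𝔢𝔣𝔭 ] A

  -- Calculus of renamings and substitutions

  wk : Tm Ξ τ → Tm (σ ∷ Ξ) τ
  wk = rename there

  -- Substitutions are functions, compared pointwise to avoid function extensionality in the
  -- metatheory.
  _≗ˢ_ : Subst Ξ Ξ′ → Subst Ξ Ξ′ → Set
  s ≗ˢ s′ = ∀ {τ} (i : τ ∈ _) → s i ≡ s′ i

  lift-cong : {s s′ : Subst Ξ Ξ′} → s ≗ˢ s′ → lift {σ = σ} s ≗ˢ lift s′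
  lift-cong e (here p)  = refl
  lift-cong e (there i) = cong wk (e i)

  subst-cong : {s s′ : Subst Ξ Ξ′} → s ≗ˢ s′ → (t : Tm Ξ τ) → subst s t ≡ subst s′ t
  subst-cong e (var x) = refl
  subst-cong e (bnd i) = e i
  subst-cong e (con c) = refl
  subst-cong e (lam t) = cong lam (subst-cong (lift-cong e) t)
  subst-cong e (t · u) = cong₂ _·_ (subst-cong e t) (subst-cong e u)

  lift-bnd : lift {σ = σ} (bnd {Ξ}) ≗ˢ bnd
  lift-bnd (here p)  = refl
  lift-bnd (there i) = refl

  subst-bnd : (t : Tm Ξ τ) → subst bnd t ≡ t
  subst-bnd (var x) = refl
  subst-bnd (bnd i) = refl
  subst-bnd (con c) = refl
  subst-bnd (lam t) = cong lam (≡.trans (subst-cong lift-bnd t) (subst-bnd t))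
  subst-bnd (t · u) = cong₂ _·_ (subst-bnd t) (subst-bnd u)

  lift-∘-∷⁺ʳ : (s : Subst Ξ′ Ξ″) (ρ : Ξ ⊆ Ξ′) →
               (lift {σ = σ} s ∘ ∷⁺ʳ σ ρ) ≗ˢ lift (s ∘ ρ)
  lift-∘-∷⁺ʳ s ρ (here p)  = refl
  lift-∘-∷⁺ʳ s ρ (there i) = refl

  subst-rename : (s : Subst Ξ′ Ξ″) (ρ : Ξ ⊆ Ξ′) (t : Tm Ξ τ) →
                 subst s (rename ρ t) ≡ subst (s ∘ ρ) t
  subst-rename s ρ (var x) = refl
  subst-rename s ρ (bnd i) = refl
  subst-rename s ρ (con c) = refl
  subst-rename s ρ (lam t) = cong lam
    (≡.trans (subst-rename (lift s) (∷⁺ʳ _ ρ) t) (subst-cong (lift-∘-∷⁺ʳ s ρ) t))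
  subst-rename s ρ (t · u) = cong₂ _·_ (subst-rename s ρ t) (subst-rename s ρ u)

  lift-ren : (ρ : Ξ ⊆ Ξ′) → lift {σ = σ} (bnd ∘ ρ) ≗ˢ (bnd ∘ ∷⁺ʳ σ ρ)
  lift-ren ρ (here p)  = refl
  lift-ren ρ (there i) = refl

  rename-as-subst : (ρ : Ξ ⊆ Ξ′) (t : Tm Ξ τ) → rename ρ t ≡ subst (bnd ∘ ρ) t
  rename-as-subst ρ (var x) = refl
  rename-as-subst ρ (bnd i) = refl
  rename-as-subst ρ (con c) = refl
  rename-as-subst ρ (lam t) = cong lam
    (≡.trans (rename-as-subst (∷⁺ʳ _ ρ) t) (≡.sym (subst-cong (lift-ren ρ) t)))
  rename-as-subst ρ (t · u) = cong₂ _·_ (rename-as-subst ρ t) (rename-as-subst ρ u)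

  -- Seen as substitutions, renamings compose by `subst-rename`, without an induction of their own.
  rename-∷⁺ʳ-wk : (ρ : Ξ ⊆ Ξ′) (t : Tm Ξ τ) →
                  rename (∷⁺ʳ σ ρ) (wk t) ≡ wk (rename ρ t)
  rename-∷⁺ʳ-wk ρ t = begin
    rename (∷⁺ʳ _ ρ) (wk t)         ≡⟨ rename-as-subst (∷⁺ʳ _ ρ) (wk t) ⟩
    subst (bnd ∘ ∷⁺ʳ _ ρ) (wk t)    ≡⟨ subst-rename _ there t ⟩
    subst (bnd ∘ there ∘ ρ) t       ≡⟨ rename-as-subst (there ∘ ρ) t ⟨
    rename (there ∘ ρ) t            ≡⟨ rename-∘ there ρ t ⟩
    wk (rename ρ t)                 ∎
    where
    open ≡.≡-Reasoning
    rename-∘ : (ρ′ : Ξ′ ⊆ Ξ″) (ρ : Ξ ⊆ Ξ′) (t : Tm Ξ τ) →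
               rename (ρ′ ∘ ρ) t ≡ rename ρ′ (rename ρ t)
    rename-∘ ρ′ ρ t = ≡.trans (rename-as-subst (ρ′ ∘ ρ) t)
      (≡.sym (≡.trans (rename-as-subst ρ′ (rename ρ t)) (subst-rename (bnd ∘ ρ′) ρ t)))

  rename-subst : (ρ : Ξ′ ⊆ Ξ″) (s : Subst Ξ Ξ′) (t : Tm Ξ τ) →
                 rename ρ (subst s t) ≡ subst (rename ρ ∘ s) t
  rename-subst ρ s (var x) = refl
  rename-subst ρ s (bnd i) = refl
  rename-subst ρ s (con c) = refl
  rename-subst ρ s (lam t) = cong lam
    (≡.trans (rename-subst (∷⁺ʳ _ ρ) (lift s) t) (subst-cong lifted t))
    where
    lifted : (rename (∷⁺ʳ _ ρ) ∘ lift s) ≗ˢ lift (rename ρ ∘ s)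
    lifted (here p)  = refl
    lifted (there i) = rename-∷⁺ʳ-wk ρ (s i)
  rename-subst ρ s (t · u) = cong₂ _·_ (rename-subst ρ s t) (rename-subst ρ s u)

  subst-subst : (s′ : Subst Ξ′ Ξ″) (s : Subst Ξ Ξ′) (t : Tm Ξ τ) →
                subst s′ (subst s t) ≡ subst (subst s′ ∘ s) t
  subst-subst s′ s (var x) = refl
  subst-subst s′ s (bnd i) = refl
  subst-subst s′ s (con c) = refl
  subst-subst s′ s (lam t) = cong lam
    (≡.trans (subst-subst (lift s′) (lift s) t) (subst-cong lifted t))
    where
    lifted : (subst (lift s′) ∘ lift s) ≗ˢ lift (subst s′ ∘ s)
    lifted (here p)  = refl
    lifted (there i) = ≡.trans (subst-rename (lift s′) there (s i))
                               (≡.sym (rename-subst there s′ (s i)))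
  subst-subst s′ s (t · u) = cong₂ _·_ (subst-subst s′ s t) (subst-subst s′ s u)

  -- Serves to keep a term fixed inside a formula with a hole `#0`: once weakened, it survives the
  -- filling of the hole.
  wk-[] : (t : Tm Ξ τ) (u : Tm Ξ σ) → wk t [ u ] ≡ t
  wk-[] t u = ≡.trans (subst-rename (single u) there t) (subst-bnd t)

  -- Free variables and freshness

  fvs : ∀ τ → Tm Ξ σ → List (Var τ)
  -- Variables of other types are skipped, because `fresh` avoids a list of variables of a single
  -- type.
  fvs τ (var {σ} x) with σ ≟ᵀ τ
  ... | yes refl = x ∷ []
  ... | no _     = []
  fvs τ (bnd i) = []
  fvs τ (con c) = []
  fvs τ (lam t) = fvs τ t
  fvs τ (t · u) = fvs τ t ++ fvs τ u

  fvs-complete : {x : Var τ} {t : Tm Ξ σ} → x ∈FV t → x ∈ fvs τ t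
  fvs-complete {τ} var with τ ≟ᵀ τ
  ... | yes refl = here refl
  ... | no τ≢τ   = contradiction refl τ≢τ
  fvs-complete (lam p) = fvs-complete p
  fvs-complete (appˡ p) = ∈-++⁺ˡ (fvs-complete p)
  fvs-complete (appʳ {t = t} p) = ∈-++⁺ʳ (fvs _ t) (fvs-complete p)

  fvsᶜ : ∀ τ → Context → List (Var τ)
  fvsᶜ τ []      = []
  fvsᶜ τ (A ∷ Γ) = fvs τ A ++ fvsᶜ τ Γ

  ∉fvsᶜ⇒∉FVs : {x : Var τ} (Γ : Context) → x ∉ fvsᶜ τ Γ → x ∉FVs Γ
  ∉fvsᶜ⇒∉FVs []      x∉ = []
  ∉fvsᶜ⇒∉FVs (A ∷ Γ) x∉ =
    x∉ ∘ ∈-++⁺ˡ ∘ fvs-complete ∷ ∉fvsᶜ⇒∉FVs Γ (x∉ ∘ ∈-++⁺ʳ (fvs _ A))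

  freshFor : ∀ {τ} (Γ : Context) → ∃ λ (x : Var τ) → x ∉FVs Γ
  freshFor {τ} Γ with fresh (fvsᶜ τ Γ)
  ... | x , x∉ = x , ∉fvsᶜ⇒∉FVs Γ x∉

  -- `ku` changes only constants, so every occurrence of a variable persists.
  ∈FV-ku : {x : Var τ} {t : Tm Ξ σ} → x ∈FV t → x ∈FV ku t
  ∈FV-ku var      = var
  ∈FV-ku (lam p)  = lam (∈FV-ku p)
  ∈FV-ku (appˡ p) = appˡ (∈FV-ku p)
  ∈FV-ku (appʳ p) = appʳ (∈FV-ku p)

  ∉FVs-kuᶜ : {x : Var τ} (Γ : Context) → x ∉FVs kuᶜ Γ → x ∉FVs Γ
  ∉FVs-kuᶜ []      []         = []
  ∉FVs-kuᶜ (A ∷ Γ) (x∉ ∷ x∉s) = x∉ ∘ ∈FV-ku ∷ ∉FVs-kuᶜ Γ x∉s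

  -- Derived rules of classical extensional logic

  =E-[] : (C : Tm (τ ∷ []) o) {u v : Term τ} → Γ ⊢ᶜ C [ u ] → Γ ⊢ᶜ u =ᶠ v → Γ ⊢ᶜ C [ v ]
  =E-[] C d e = conv (=E {P = lam C} (∈𝔢𝔣𝔭 eq) (conv d (sym (β C _))) e) (β C _)

  =-refl : {t : Term τ} → Γ ⊢ᶜ t =ᶠ t
  =-refl = =I (∈𝔢𝔣𝔭 eq)

  =-sym : {t u : Term τ} → Γ ⊢ᶜ t =ᶠ u → Γ ⊢ᶜ u =ᶠ t
  =-sym {Γ = Γ} {t} {u} d =
    ≡.subst (λ t′ → Γ ⊢ᶜ u =ᶠ t′) (wk-[] t u)
      -- Only the left side of `t =ᶠ t` is rewritten.
      (=E-[] (#0 =ᶠ wk t)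
        (≡.subst (λ t′ → Γ ⊢ᶜ t =ᶠ t′) (≡.sym (wk-[] t t)) =-refl) d)

  =-trans : {t u v : Term τ} → Γ ⊢ᶜ t =ᶠ u → Γ ⊢ᶜ u =ᶠ v → Γ ⊢ᶜ t =ᶠ v
  =-trans {Γ = Γ} {t} {u} {v} d e =
    ≡.subst (λ t′ → Γ ⊢ᶜ t′ =ᶠ v) (wk-[] t v)
      (=E-[] (wk t =ᶠ #0) (≡.subst (λ t′ → Γ ⊢ᶜ t′ =ᶠ u) (≡.sym (wk-[] t u)) d) e)

  =-cong : (C : Tm (τ ∷ []) σ) {u v : Term τ} → Γ ⊢ᶜ u =ᶠ v → Γ ⊢ᶜ C [ u ] =ᶠ C [ v ]
  =-cong {Γ = Γ} C {u} {v} d =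
    ≡.subst (λ t → Γ ⊢ᶜ t =ᶠ C [ v ]) (wk-[] (C [ u ]) v)
      (=E-[] (wk (C [ u ]) =ᶠ C)
        (≡.subst (λ t → Γ ⊢ᶜ t =ᶠ C [ u ]) (≡.sym (wk-[] (C [ u ]) u)) =-refl) d)

  =-app : {f g : Term (τ ⟶ σ)} {u v : Term τ} →
          Γ ⊢ᶜ f =ᶠ g → Γ ⊢ᶜ u =ᶠ v → Γ ⊢ᶜ f · u =ᶠ g · v
  =-app {Γ = Γ} {f} {g} {u} {v} d e = =-trans
    -- The middle term is `g · u`: the function is rewritten first, then the argument.
    (≡.subst (λ u′ → Γ ⊢ᶜ f · u′ =ᶠ g · u)  (wk-[] u f)
      (≡.subst (λ u′ → Γ ⊢ᶜ f · (wk u [ f ]) =ᶠ g · u′) (wk-[] u g) (=-cong (#0 · wk u) d)))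
    (≡.subst (λ g′ → Γ ⊢ᶜ g′ · u =ᶠ g · v) (wk-[] g u)
      (≡.subst (λ g′ → Γ ⊢ᶜ (wk g [ u ]) · u =ᶠ g′ · v) (wk-[] g v) (=-cong (wk g · #0) e)))

  =-coe : Γ ⊢ᶜ A =ᶠ B → Γ ⊢ᶜ A → Γ ⊢ᶜ B
  =-coe e d = =E-[] #0 d e

  -- Asking the premise for every `x` hides the choice of the eigenvariable from later proofs.
  =-ext : {f g : Term (τ ⟶ σ)} → (∀ x → Γ ⊢ᶜ f · var x =ᶠ g · var x) → Γ ⊢ᶜ f =ᶠ g
  =-ext {Γ = Γ} {f} {g} d with freshFor ((f =ᶠ g) ∷ Γ)
  ... | x , x∉f=g ∷ x∉Γ =
    funE (∈𝔢𝔣𝔭 funExt) x x∉Γ (x∉f=g ∘ appˡ ∘ appʳ) (x∉f=g ∘ appʳ) (d x)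

  =-lam : {t u : Tm (τ ∷ []) σ} →
          (∀ x → Γ ⊢ᶜ t [ var x ] =ᶠ u [ var x ]) → Γ ⊢ᶜ lam t =ᶠ lam u
  =-lam d = =-ext λ x → conv (d x) (app (app refl (sym (β _ _))) (sym (β _ _)))

  ∀I-fresh : {P : Term (τ ⟶ o)} → (∀ x → Γ ⊢ᶜ P · var x) → Γ ⊢ᶜ ∀ᶠ P
  ∀I-fresh {Γ = Γ} {P} d with freshFor ((∀ᶠ P) ∷ Γ)
  ... | x , x∉∀P ∷ x∉Γ = ∀I x x∉Γ (x∉∀P ∘ appʳ) (d x)

  -- An implication, because ⊢ has no weakening rule to apply to a derivation of ¬ᶠ ¬ᶠ A.
  ¬¬-elim : Γ ⊢ᶜ (¬ᶠ ¬ᶠ A) ⇒ᶠ A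
  ¬¬-elim = ⇒I (∨E (pem refl) (ax (here refl)) (⊥E (¬E (ax (there (here refl))) (ax (here refl)))))

  ¬¬-intro : Γ ⊢ᶜ A ⇒ᶠ ¬ᶠ ¬ᶠ A
  ¬¬-intro = ⇒I (¬I (¬E (ax (here refl)) (ax (there (here refl)))))

  -- Kuroda's translation and the schema `Δᶠ` in classical logic

  ∀-ku : ∀ τ → Γ ⊢ᶜ con (∀ᶜ τ) =ᶠ ku (con (∀ᶜ τ))
  ∀-ku τ = =-ext λ p → propE (∈𝔢𝔣𝔭 propExt) (∧I
    -- The outer conversion folds the β-redex `ku (con (∀ᶜ τ)) · p`, the inner one the body of its
    -- quantifier.
    (⇒I (conv (∀I-fresh λ x →
      conv (⇒E ¬¬-intro (∀E (var x) (ax (here refl)))) (sym (β _ _))) (sym (β _ _))))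
    (⇒I (∀I-fresh λ x →
      ⇒E ¬¬-elim (conv (∀E (var x) (conv (ax (here refl)) (β _ _))) (β _ _)))))

  _▸_ : Subst Ξ [] → Term τ → Subst (τ ∷ Ξ) []
  (s ▸ u) (here refl) = u
  (s ▸ u) (there i)   = s i

  -- Instantiating the body of a substituted λ is again a single closing substitution, as the λ case
  -- of `subst-ku` requires.
  lift-[] : (s : Subst Ξ []) (u : Term σ) (t : Tm (σ ∷ Ξ) τ) →
            subst (lift s) t [ u ] ≡ subst (s ▸ u) t
  lift-[] s u t = ≡.trans (subst-subst (single u) (lift s) t) (subst-cong pointwise t)
    where
    pointwise : (subst (single u) ∘ lift s) ≗ˢ (s ▸ u)
    pointwise (here refl) = refl
    pointwise (there i)   = wk-[] (s i) u

  -- Derivations speak of closed terms only, so the induction carries a closing substitution `s`,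
  -- extended by a variable under each λ.
  subst-ku : (s : Subst Ξ []) (t : Tm Ξ τ) → Γ ⊢ᶜ subst s t =ᶠ subst s (ku t)
  subst-ku s (var x)           = =-refl
  subst-ku s (bnd i)           = =-refl
  -- The constants are listed one by one because `ku (con c)` reduces only when the constructor of
  -- `c` is known.
  subst-ku s (con ⊤ᶜ)          = =-refl
  subst-ku s (con ⊥ᶜ)          = =-refl
  subst-ku s (con ¬ᶜ)          = =-refl
  subst-ku s (con ⇒ᶜ)          = =-refl
  subst-ku s (con ∧ᶜ)          = =-refl
  subst-ku s (con ∨ᶜ)          = =-refl
  subst-ku s (con (∀ᶜ τ))      = ∀-ku τ
  subst-ku s (con (∃ᶜ τ))      = =-refl
  subst-ku s (con (=ᶜ τ))      = =-refl
  subst-ku s (con (other c))   = =-refl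
  subst-ku {Γ = Γ} s (lam t)   = =-lam λ x →
    ≡.subst₂ (λ a b → Γ ⊢ᶜ a =ᶠ b)
      (≡.sym (lift-[] s (var x) t)) (≡.sym (lift-[] s (var x) (ku t)))
      (subst-ku (s ▸ var x) t)
  subst-ku s (t · u)           = =-app (subst-ku s t) (subst-ku s u)

  =-ku : (t : Term τ) → Γ ⊢ᶜ t =ᶠ ku t
  =-ku {Γ = Γ} t = ≡.subst₂ (λ a b → Γ ⊢ᶜ a =ᶠ b) (subst-bnd t) (subst-bnd (ku t)) (subst-ku bnd t)

  Δᶠ-derivable : ∀ τσ → Γ ⊢ᶜ Δᶠ τσ
  Δᶠ-derivable τσ =
    ∀I-fresh λ f → conv (∀I-fresh λ g → conv
      (⇒I (⇒E ¬¬-intro (=-ext λ x →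
        ⇒E ¬¬-elim (conv (∀E (var x) (ax (here refl))) (β _ _)))))
      (sym (β _ _))) (sym (β _ _))

  -- Cutting derivable hypotheses

  -- By induction on the derivation. Quantifying over `Θ` builds weakening into the first premise;
  -- the second transports eigenvariable conditions.
  cut : (∀ {A} → A ∈ Δ → ∀ Θ → Γ ⊆ Θ → Θ ⊢ᶜ A) →
        (∀ {τ} {x : Var τ} → x ∉FVs Δ → x ∉FVs Γ) →
        Δ ⊢[ k , * ] B → Γ ⊢ᶜ B
  -- Both premises of `cut` are stable under adding one formula to both contexts, which is what
  -- rules that discharge a hypothesis ask for.
  cut-∷ : (∀ {A} → A ∈ Δ → ∀ Θ → Γ ⊆ Θ → Θ ⊢ᶜ A) →
          (∀ {τ} {x : Var τ} → x ∉FVs Δ → x ∉FVs Γ) →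
          A ∷ Δ ⊢[ k , * ] B → A ∷ Γ ⊢ᶜ B
  cut h v (ax i)                 = h i _ id
  cut h v (conv d e)             = conv (cut h v d) e
  cut h v ⊤I                     = ⊤I
  cut h v (⊥E d)                 = ⊥E (cut h v d)
  cut h v (¬I d)                 = ¬I (cut-∷ h v d)
  cut h v (¬E d e)               = ¬E (cut h v d) (cut h v e)
  cut h v (⇒I d)                 = ⇒I (cut-∷ h v d)
  cut h v (⇒E d e)               = ⇒E (cut h v d) (cut h v e)
  cut h v (∧I d e)               = ∧I (cut h v d) (cut h v e)
  cut h v (∧E₁ d)                = ∧E₁ (cut h v d)
  cut h v (∧E₂ d)                = ∧E₂ (cut h v d)
  cut h v (∨I₁ d)                = ∨I₁ (cut h v d)
  cut h v (∨I₂ d)                = ∨I₂ (cut h v d)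
  cut h v (∨E d e f)             = ∨E (cut h v d) (cut-∷ h v e) (cut-∷ h v f)
  cut h v (∀I x x∉Δ x∉P d)       = ∀I x (v x∉Δ) x∉P (cut h v d)
  cut h v (∀E t d)               = ∀E t (cut h v d)
  cut h v (∃I t d)               = ∃I t (cut h v d)
  cut h v (∃E x x∉Δ x∉P x∉A d e) = ∃E x (v x∉Δ) x∉P x∉A (cut h v d) (cut-∷ h v e)
  cut h v (pem _)                = pem refl
  cut h v (=I _)                 = =-refl
  cut h v (=E _ d e)             = =E (∈𝔢𝔣𝔭 eq) (cut h v d) (cut h v e)
  cut h v (funE _ x x∉Δ x∉f x∉g d) = funE (∈𝔢𝔣𝔭 funExt) x (v x∉Δ) x∉f x∉g (cut h v d)
  cut h v (propE _ d)            = propE (∈𝔢𝔣𝔭 propExt) (cut h v d)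

  cut-∷ h v = cut
    (λ { (here refl) Θ i → ax (i (here refl)) ; (there j) Θ i → h j Θ (i ∘ there) })
    (λ { (x∉A ∷ x∉Δ) → x∉A ∷ v x∉Δ })

  -- From the translated sequent back to the original

  -- The cut gives the double negation of `ku A`; eliminating it and rewriting along `A =ᶠ ku A`
  -- backwards gives `A`.
  ku-reflect : Δᶠ, kuᶜ Γ ⊢[ k , * ] A ᴷᵘ → Γ ⊢ᶜ A
  ku-reflect {Γ} {A = A} (τσs , d) = =-coe (=-sym (=-ku A)) (⇒E ¬¬-elim (cut hyps vars d))
    where
    hyps : ∀ {B} → B ∈ kuᶜ Γ ++ map Δᶠ τσs → ∀ Θ → Γ ⊆ Θ → Θ ⊢ᶜ B
    hyps B∈ Θ Γ⊆Θ = [ fromΓ , fromΔ ]′ (∈-++⁻ (kuᶜ Γ) B∈)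
      where
      fromΓ : ∀ {B} → B ∈ kuᶜ Γ → Θ ⊢ᶜ B
      fromΓ i with ∈-map⁻ ku i
      -- `=-ku` holds in any context, hence directly in `Θ`.
      ... | C , C∈Γ , refl = =-coe (=-ku C) (ax (Γ⊆Θ C∈Γ))
      fromΔ : ∀ {B} → B ∈ map Δᶠ τσs → Θ ⊢ᶜ B
      fromΔ i with ∈-map⁻ Δᶠ i
      ... | τσ , _ , refl = Δᶠ-derivable τσ
    vars : ∀ {τ} {x : Var τ} → x ∉FVs (kuᶜ Γ ++ map Δᶠ τσs) → x ∉FVs Γ
    vars = ∉FVs-kuᶜ Γ ∘ ++⁻ˡ (kuᶜ Γ)

  ku-reflect₀ : kuᶜ Γ ⊢[ k , * ] A ᴷᵘ → Γ ⊢ᶜ A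
  ku-reflect₀ {Γ} {k} {*} {A} d =
    -- With no instance of `Δᶠ`, the context `kuᶜ Γ ++ []` equals `kuᶜ Γ` only propositionally.
    ku-reflect ([] , ≡.subst (λ Δ → Δ ⊢[ k , * ] A ᴷᵘ) (≡.sym (++-identityʳ (kuᶜ Γ))) d)

theorem6 : (S : Signature) → let open HOL S in
    (A : Formula) (Γ : Context) →
    (kuᶜ Γ ⊢[ int , [] ] A ᴷᵘ → Γ ⊢[ cls , 𝔢𝔣𝔭 ] A)
    × (∀ * → * ∈ 𝔢 ∷ 𝔢𝔭 ∷ [] →
    kuᶜ Γ ⊢[ int , * ] A ᴷᵘ → Γ ⊢[ cls , 𝔢𝔣𝔭 ] A)
    × (∀ * → * ∈ 𝔢𝔣 ∷ 𝔢𝔣𝔭 ∷ [] →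
    Δᶠ, kuᶜ Γ ⊢[ int , * ] A ᴷᵘ → Γ ⊢[ cls , 𝔢𝔣𝔭 ] A)
theorem6 S A Γ = ku-reflect₀ S , (λ _ _ → ku-reflect₀ S) , (λ _ _ → ku-reflect S)
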